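{- Let $X$, $Y$ be graphs, let $\varphi:X\to Y$ be a complete orbit homomorphism, and let $C\in\mathcal{C}(X)$. (i) If $y,\overline{y}\in V_{\varphi(C)}$, then $\frac{k_X(y)}{k_C(y)}=\frac{k_X(\overline{y})}{k_C(\overline{y})}$. (ii) $C\cong\varphi(C)$ if and only if there exists $y\in V_{\varphi(C)}$ such that $k_C(y)=1$ and, for every $\overline{y}\in V_{\varphi(C)}$, $k_X(y)=k_X(\overline{y})$. (iii) If there exists $y\in V_{\varphi(C)}$ such that $k_C(y)=k_X(y)$, then for every $\overline{y}\in V_{\varphi(C)}$, $k_C(\overline{y})=k_X(\overline{y})$. (iv) If there exists $y\in V_{\varphi(C)}$ such that $k_C(y)=k_X(y)>1$, then $C\not\cong\varphi(C)$.
   Context: All graphs are finite, undirected, simple and reflexive: a graph $X=(V_X,E_X)$ has a finite nonempty vertex set $V_X$, and $E_X$ consists of all loops $\{x\}$ ($x\in V_X$) together with a (possibly empty) set of $2$-element subsets of $V_X$. A homomorphism $\varphi:X\to Y$ is a map $\varphi:V_X\to V_Y$ such that $\{x_1,x_2\}\in E_X$ implies $\{\varphi(x_1),\varphi(x_2)\}\in E_Y$ (a proper edge may be mapped to a loop). For a subgraph $\hat X$ of $X$, $\varphi(\hat X)=(\varphi(V_{\hat X}),\varphi(E_{\hat X}))$. $\varphi$ is complete if $\varphi(V_X)=V_Y$ and $\varphi(E_X)=E_Y$. $\varphi$ is an orbit homomorphism if there is a subgroup $\mathfrak{G}\leq\mathrm{Aut}(X)$ such that the nonempty fibres of $\varphi$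 are exactly the orbits of $\mathfrak{G}$ on $V_X$. $\cong$ denotes graph isomorphism (existence of a bijective homomorphism mapping edges onto edges). $\mathcal{C}(X)$ is the set of components (maximal connected subgraphs) of $X$; for $y\in V_Y$ and a subgraph $\hat X$ of $X$, $k_{\hat X}(y)=|V_{\hat X}\cap\varphi^{ -1}(y)|$ (so $k_X(y)=|\varphi^{ -1}(y)|$). -}

module Defs where

open import Algebra.Bundles using (Group)
open import Data.Bool using (true)
open import Data.Fin using (Fin; zero; _≟_)
open import Data.Fin.Properties using (any?)
open import Data.Fin.Subset using (Subset; _∈_; _⊆_; _∩_; ⊤; ∣_∣; Nonempty)
open import Data.Fin.Subset.Properties using (_∈?_; ∈⊤; x∈p∩q⁺; x∈p⇒∣p-x∣<∣p∣)
open import Data.Nat using (ℕ; suc; NonZero; z≤n; >-nonZero)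
open import Data.Nat.Properties using (≤-<-trans)
open import Data.Product using (Σ; ∃; ∃₂; _×_; _,_; proj₁; proj₂)
open import Data.Vec using (tabulate)
open import Data.Vec.Properties using (lookup∘tabulate; []=⇒lookup; lookup⇒[]=)
open import Function using (_∘_; id; _on_)
open import Function.Definitions using (Injective; StrictlySurjective)
open import Level using (Level; 0ℓ) renaming (suc to lsuc; _⊔_ to _⊔ˡ_)
open import Relation.Binary using (Rel; Reflexive; Symmetric; Decidable; _⇒_; _=[_]⇒_)
open import Relation.Binary.Construct.Closure.ReflexiveTransitive using (Star)
open import Relation.Binary.PropositionalEquality
  using (_≡_; refl; sym; trans; cong; subst₂)
open import Relation.Nullary using (Dec; yes; does)
open import Relation.Nullary.Decidable using (_×-dec_; dec-true)
import Relation.Unary as U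

private
  variable
    n : ℕ

⟦_⟧ : {P : U.Pred (Fin n) 0ℓ} → U.Decidable P → Subset n
⟦ P? ⟧ = tabulate (does ∘ P?)

module _ {P : U.Pred (Fin n) 0ℓ} (P? : U.Decidable P) where

  ∈⟦⟧⁺ : ∀ {x} → P x → x ∈ ⟦ P? ⟧
  ∈⟦⟧⁺ {x} px =
    lookup⇒[]= x ⟦ P? ⟧ (trans (lookup∘tabulate (does ∘ P?) x) (dec-true (P? x) px))

  ∈⟦⟧⁻ : ∀ {x} → x ∈ ⟦ P? ⟧ → P x
  ∈⟦⟧⁻ {x} x∈ =
    witness (P? x) (trans (sym (lookup∘tabulate (does ∘ P?) x)) ([]=⇒lookup x∈))
    where
    witness : {A : Set} (a? : Dec A) → does a? ≡ true → A
    witness (yes a) _ = a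

-- x ~ y means that {x , y} is an edge; x ~ x is the loop {x}.  Decidability
-- makes the edge set a finite set constructively, and is required of the
-- edge set of a subgraph for the same reason.

record Graph : Set₁ where
  infix 4 _~_
  field
    order   : ℕ
    nonZero : NonZero order
    _~_     : Rel (Fin order) 0ℓ
    _~?_    : Decidable _~_
    ~-refl  : Reflexive _~_
    ~-sym   : Symmetric _~_

-- A subgraph is itself a graph: it is nonempty and has a loop at each of
-- its vertices.  It need not be induced.

record Subgraph (X : Graph) : Set₁ where
  open Graph X
  field
    vertices  : Subset order
    nonempty  : Nonempty vertices
    Edge      : Rel (Fin order) 0ℓ
    edge?     : Decidable Edge
    edge-refl : ∀ {x} → x ∈ vertices → Edge x x
    edge-sym  : Symmetric Edge
    edge⇒∈    : ∀ {x y} → Edge x y → x ∈ vertices × y ∈ vertices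
    edge⇒~    : Edge ⇒ _~_

  Vertex : Set
  Vertex = ∃ (_∈ vertices)

  Adjacent : Rel Vertex 0ℓ
  Adjacent = Edge on proj₁

open Subgraph using (vertices)

whole : (X : Graph) → Subgraph X
whole X = record
  { vertices  = ⊤
  ; nonempty  = ⊤-nonempty nonZero
  ; Edge      = _~_
  ; edge?     = _~?_
  ; edge-refl = λ _ → ~-refl
  ; edge-sym  = ~-sym
  ; edge⇒∈    = λ _ → ∈⊤ , ∈⊤
  ; edge⇒~    = id
  }
  where
  open Graph X
  ⊤-nonempty : ∀ {m} → NonZero m → Nonempty (⊤ {m})
  ⊤-nonempty {suc _} _ = zero , ∈⊤

module _ {X : Graph} where

  infix 4 _⊑_

  _⊑_ : Rel (Subgraph X) 0ℓ
  S ⊑ S′ = vertices S ⊆ vertices S′ × (Subgraph.Edge S ⇒ Subgraph.Edge S′)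

  Connected : Subgraph X → Set
  Connected S = ∀ {x y} → x ∈ vertices S → y ∈ vertices S → Star (Subgraph.Edge S) x y

  IsComponent : Subgraph X → Set₁
  IsComponent C = Connected C × (∀ D → Connected D → C ⊑ D → D ⊑ C)

-- Edges are handled as ordered pairs; for symmetric relations, hitting
-- every ordered pair is the same as hitting every unordered one.

module _ {A B : Set} (_~₁_ : Rel A 0ℓ) (_~₂_ : Rel B 0ℓ) (f : A → B) where

  IsHomomorphism : Set
  IsHomomorphism = _~₁_ =[ f ]⇒ _~₂_

  EdgeSurjective : Set
  EdgeSurjective = ∀ {y₁ y₂} → y₁ ~₂ y₂ →
                   ∃₂ λ x₁ x₂ → x₁ ~₁ x₂ × f x₁ ≡ y₁ × f x₂ ≡ y₂

  record IsIsomorphism : Set where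
    field
      homomorphism   : IsHomomorphism
      injective      : Injective _≡_ _≡_ f
      surjective     : StrictlySurjective _≡_ f
      edgeSurjective : EdgeSurjective

infix 4 _≅_

_≅_ : ∀ {X Y} → Subgraph X → Subgraph Y → Set
S ≅ T = ∃ (IsIsomorphism (Subgraph.Adjacent S) (Subgraph.Adjacent T))

record Hom (X Y : Graph) : Set where
  private
    module X = Graph X
    module Y = Graph Y
  field
    ⟨_⟩      : Fin X.order → Fin Y.order
    preserve : IsHomomorphism X._~_ Y._~_ ⟨_⟩

open Hom using (⟨_⟩)

IsComplete : ∀ {X Y} → Hom X Y → Set
IsComplete {X} {Y} φ =
  StrictlySurjective _≡_ ⟨ φ ⟩ × EdgeSurjective (Graph._~_ X) (Graph._~_ Y) ⟨ φ ⟩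

module _ {X Y : Graph} (φ : Hom X Y) where
  private
    module X = Graph X
    module Y = Graph Y

  fibre : Fin Y.order → Subset X.order
  fibre y = ⟦ (λ x → ⟨ φ ⟩ x ≟ y) ⟧

  image : Subgraph X → Subgraph Y
  image S = record
    { vertices  = ⟦ inImage? ⟧
    ; nonempty  = _ , ∈⟦⟧⁺ inImage? (_ , proj₂ nonempty , refl)
    ; Edge      = ImageEdge
    ; edge?     = λ y₁ y₂ → any? λ x₁ → any? λ x₂ →
                    edge? x₁ x₂ ×-dec (⟨ φ ⟩ x₁ ≟ y₁) ×-dec (⟨ φ ⟩ x₂ ≟ y₂)
    ; edge-refl = λ y∈ → let x , x∈ , e = ∈⟦⟧⁻ inImage? y∈ in
                    x , x , edge-refl x∈ , e , e
    ; edge-sym  = λ (x₁ , x₂ , x₁~x₂ , e₁ , e₂) → x₂ , x₁ , edge-sym x₁~x₂ , e₂ , e₁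
    ; edge⇒∈    = λ (x₁ , x₂ , x₁~x₂ , e₁ , e₂) →
                    ∈⟦⟧⁺ inImage? (x₁ , proj₁ (edge⇒∈ x₁~x₂) , e₁) ,
                    ∈⟦⟧⁺ inImage? (x₂ , proj₂ (edge⇒∈ x₁~x₂) , e₂)
    ; edge⇒~    = λ (x₁ , x₂ , x₁~x₂ , e₁ , e₂) →
                    subst₂ Y._~_ e₁ e₂ (Hom.preserve φ (edge⇒~ x₁~x₂))
    }
    where
    open Subgraph S hiding (vertices)

    InImage : U.Pred (Fin Y.order) 0ℓ
    InImage y = ∃ λ x → x ∈ vertices S × ⟨ φ ⟩ x ≡ y

    inImage? : U.Decidable InImage
    inImage? y = any? λ x → (x ∈? vertices S) ×-dec (⟨ φ ⟩ x ≟ y)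

    ImageEdge : Rel (Fin Y.order) 0ℓ
    ImageEdge y₁ y₂ = ∃₂ λ x₁ x₂ → Edge x₁ x₂ × ⟨ φ ⟩ x₁ ≡ y₁ × ⟨ φ ⟩ x₂ ≡ y₂

  k : Subgraph X → Fin Y.order → ℕ
  k S y = ∣ vertices S ∩ fibre y ∣

  k-nonZero : ∀ S {y} → y ∈ vertices (image S) → NonZero (k S y)
  k-nonZero S {y} y∈ =
    let x , x∈ , e = ∈⟦⟧⁻ (λ z → any? λ x → (x ∈? vertices S) ×-dec (⟨ φ ⟩ x ≟ z)) y∈
        x∈∩        = x∈p∩q⁺ (x∈ , ∈⟦⟧⁺ (λ x → ⟨ φ ⟩ x ≟ y) e)
    in >-nonZero (≤-<-trans z≤n (x∈p⇒∣p-x∣<∣p∣ x∈∩))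

Automorphism : Graph → Set
Automorphism X = Σ (Fin order → Fin order) (IsIsomorphism _~_ _~_)
  where open Graph X

-- The product σ ∙ τ is σ after τ; automorphisms are compared pointwise.

Aut : Graph → Group 0ℓ 0ℓ
Aut X = record
  { Carrier = Automorphism X
  ; _≈_     = λ σ τ → ∀ x → proj₁ σ x ≡ proj₁ τ x
  ; _∙_     = compose
  ; ε       = id , record
    { homomorphism   = id
    ; injective      = id
    ; surjective     = λ y → y , refl
    ; edgeSurjective = λ y₁~y₂ → _ , _ , y₁~y₂ , refl , refl
    }
  ; _⁻¹     = inverse
  ; isGroup = record
    { isMonoid = record
      { isSemigroup = record
        { isMagma = record
          { isEquivalence = record
            { refl  = λ _ → refl
            ; sym   = λ p x → sym (p x)
            ; trans = λ p q x → trans (p x) (q x)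
            }
          ; ∙-cong = λ {σ} {_} {_} {τ′} p q x → trans (cong (proj₁ σ) (q x)) (p (proj₁ τ′ x))
          }
        ; assoc = λ _ _ _ _ → refl
        }
      ; identity = (λ _ _ → refl) , (λ _ _ → refl)
      }
    ; inverse = inverseˡ , inverseʳ
    ; ⁻¹-cong = λ {σ} {τ} p x → injective (proj₂ τ)
        (trans (sym (p _)) (trans (inverseʳ σ x) (sym (inverseʳ τ x))))
    }
  }
  where
  open Graph X
  open IsIsomorphism

  compose : Automorphism X → Automorphism X → Automorphism X
  compose (f , fIso) (g , gIso) = f ∘ g , record
    { homomorphism   = homomorphism fIso ∘ homomorphism gIso
    ; injective      = injective gIso ∘ injective fIso
    ; surjective     = λ z →
        let y , fy≡z = surjective fIso z
            x , gx≡y = surjective gIso y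
        in x , trans (cong f gx≡y) fy≡z
    ; edgeSurjective = λ z₁~z₂ →
        let _  , _  , y₁~y₂ , p₁ , p₂ = edgeSurjective fIso z₁~z₂
            x₁ , x₂ , x₁~x₂ , q₁ , q₂ = edgeSurjective gIso y₁~y₂
        in x₁ , x₂ , x₁~x₂ , trans (cong f q₁) p₁ , trans (cong f q₂) p₂
    }

  inverse : Automorphism X → Automorphism X
  inverse (f , fIso) = f⁻¹ , record
    { homomorphism   = λ y₁~y₂ →
        let _ , _ , x₁~x₂ , p₁ , p₂ = edgeSurjective fIso y₁~y₂
        in subst₂ _~_ (f⁻¹-unique p₁) (f⁻¹-unique p₂) x₁~x₂
    ; injective      = λ {x} {y} p →
        trans (sym (f∘f⁻¹ x)) (trans (cong f p) (f∘f⁻¹ y))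
    ; surjective     = λ x → f x , sym (f⁻¹-unique refl)
    ; edgeSurjective = λ {x₁} {x₂} x₁~x₂ →
        f x₁ , f x₂ , homomorphism fIso x₁~x₂ ,
        sym (f⁻¹-unique refl) , sym (f⁻¹-unique refl)
    }
    where
    f⁻¹ : Fin order → Fin order
    f⁻¹ y = proj₁ (surjective fIso y)

    f∘f⁻¹ : ∀ y → f (f⁻¹ y) ≡ y
    f∘f⁻¹ y = proj₂ (surjective fIso y)

    f⁻¹-unique : ∀ {x y} → f x ≡ y → x ≡ f⁻¹ y
    f⁻¹-unique {x} {y} p = injective fIso (trans p (sym (f∘f⁻¹ y)))

  inverseʳ : ∀ (σ : Automorphism X) x → proj₁ (compose σ (inverse σ)) x ≡ x
  inverseʳ (_ , fIso) x = proj₂ (surjective fIso x)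

  inverseˡ : ∀ (σ : Automorphism X) x → proj₁ (compose (inverse σ) σ) x ≡ x
  inverseˡ σ@(f , fIso) x = injective fIso (inverseʳ σ (f x))

-- respects: Member is a subset of a setoid, so it must be closed under _≈_.

record Subgroup {c ℓ} (G : Group c ℓ) (p : Level) : Set (c ⊔ˡ ℓ ⊔ˡ lsuc p) where
  open Group G
  field
    Member    : U.Pred Carrier p
    respects  : ∀ {g h} → g ≈ h → Member g → Member h
    ε-closed  : Member ε
    ∙-closed  : ∀ {g h} → Member g → Member h → Member (g ∙ h)
    ⁻¹-closed : ∀ {g} → Member g → Member (g ⁻¹)

Orbit : ∀ {X} → Subgroup (Aut X) 0ℓ → Fin (Graph.order X) → U.Pred (Fin (Graph.order X)) 0ℓ
Orbit 𝔊 x x′ = ∃ λ σ → Subgroup.Member 𝔊 σ × proj₁ σ x ≡ x′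

-- The set of nonempty fibres and the set of orbits include each other.

IsOrbitHomomorphism : ∀ {X Y} → Hom X Y → Set₁
IsOrbitHomomorphism {X} φ = Σ (Subgroup (Aut X) 0ℓ) λ 𝔊 →
  (∀ y → Nonempty (fibre φ y) → ∃ λ x → (_∈ fibre φ y) U.≐ Orbit {X} 𝔊 x) ×
  (∀ x → ∃ λ y → Nonempty (fibre φ y) × (_∈ fibre φ y) U.≐ Orbit {X} 𝔊 x)

-- Write k_X and k_C for the fibre sizes.  Everything rests on the identity
-- k_X(y) · k_C(ȳ) = k_X(ȳ) · k_C(y) for y, ȳ ∈ φ(C), obtained by counting in
-- two ways the pairs (a , b) with φ(a) = y, φ(b) = ȳ and a, b in the same
-- component.  Fix base points c, c̄ ∈ C above y, ȳ, and for a above y choose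
-- σ_a ∈ 𝔊 with σ_a c = a: it carries C ∩ φ⁻¹(ȳ) onto the points above ȳ in
-- the component of a; likewise τ_b with τ_b c̄ = b for b above ȳ.  Then
-- (a , b′) ↦ (σ_a b′ , τ_b⁻¹ a), where b = σ_a b′, is an injection of
-- φ⁻¹(y) × (C ∩ φ⁻¹(ȳ)) into φ⁻¹(ȳ) × (C ∩ φ⁻¹(y)), and the roles of y and ȳ
-- may be exchanged.  For C ≅ φ(C) ⇒ k_C ≡ 1, a section of φ on C composed
-- with the isomorphism is an injective, hence surjective, self-map of the
-- finite set V_C, so φ is injective on C.

module Submission where

open import Algebra.Bundles using (Group)
open import Data.Fin using (Fin; zero; suc; _≟_; punchOut)
open import Data.Fin.Properties using (any?; injective⇒≤; punchOut-injective; *↔×)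
open import Data.Fin.Subset using (Subset; _∈_; _∪_; _∩_; ⁅_⁆; ∣_∣; Nonempty; inside; outside)
open import Data.Fin.Subset.Properties
  using (_∈?_; ∈⊤; x∈p∩q⁺; x∈p∩q⁻; x∈p∪q⁺; x∈p∪q⁻; x∈⁅x⁆; x∈⁅y⁆⇒x≡y)
open import Data.Integer using (+_)
import Data.Integer.Properties as ℤ
open import Data.Nat using (ℕ; suc; _*_; _≤_; _>_; NonZero)
open import Data.Nat.Properties
  using (≤-antisym; 1+n≰n; *-cancelˡ-≡; *-comm; *-identityʳ; <-irrefl)
open import Data.Product using (∃; _×_; _,_; proj₁; proj₂; map)
open import Data.Product.Function.NonDependent.Propositional using (_×-↔_)
open import Data.Rational using (_/_)
open import Data.Rational.Properties using (fromℚᵘ-cong)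
open import Data.Rational.Unnormalised using (mkℚᵘ; *≡*)
open import Data.Sum using (inj₁; inj₂)
open import Data.Vec using (_∷_; here; there)
open import Data.Vec.Properties.WithK using ([]=-irrelevant)
open import Function using (_∘_)
open import Function.Bundles using (_⇔_; _↔_; Inverse; Injection; mk⇔; mk↔ₛ′)
open import Function.Construct.Composition using (_↔-∘_)
open import Function.Definitions using (Injective; StrictlySurjective)
open import Function.Properties.Inverse using (↔-sym; ↔⇒↣)
open import Relation.Binary.Construct.Closure.ReflexiveTransitive
  using (Star; ε; _◅_; _◅◅_; gmap; reverse)
open import Relation.Binary.PropositionalEquality
  using (_≡_; refl; sym; trans; cong; cong₂; subst; module ≡-Reasoning)
open import Relation.Nullary using (¬_; yes; no; contradiction)
open import Relation.Nullary.Decidable using (_×-dec_)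
open import Defs

open Subgraph using (vertices)
open Hom using (⟨_⟩)
open IsIsomorphism

private
  variable
    m n : ℕ
    A B : Set

-- Finite sets

injective⇒∣∣≤ : Fin m ↔ A → Fin n ↔ B → {f : A → B} → Injective _≡_ _≡_ f → m ≤ n
injective⇒∣∣≤ m↔A n↔B f-inj = injective⇒≤
  (Injection.injective (↔⇒↣ m↔A) ∘ f-inj ∘ Injection.injective (↔⇒↣ (↔-sym n↔B)))

-- If `y` were missed, punching it out of the codomain would inject `Fin (suc n)` into `Fin n`.
Fin-injective⇒surjective : {f : Fin n → Fin n} →
                           Injective _≡_ _≡_ f → StrictlySurjective _≡_ f
Fin-injective⇒surjective {suc n} {f} f-inj y with any? (λ x → f x ≟ y)
... | yes hit = hit
... | no miss = contradiction
  (injective⇒≤ {f = λ x → punchOut (y≢f x)}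
    (λ {x} {x′} → f-inj ∘ punchOut-injective (y≢f x) (y≢f x′)))
  1+n≰n
  where
  y≢f : ∀ x → ¬ y ≡ f x
  y≢f x e = miss (x , sym e)

injective⇒surjective : Fin n ↔ A → {f : A → A} →
                       Injective _≡_ _≡_ f → StrictlySurjective _≡_ f
injective⇒surjective n↔A {f} f-inj y =
  let i , e = Fin-injective⇒surjective
                (Injection.injective (↔⇒↣ n↔A) ∘ f-inj ∘ Injection.injective (↔⇒↣ (↔-sym n↔A)))
                (from y)
  in to i , Injection.injective (↔⇒↣ (↔-sym n↔A)) e
  where open Inverse n↔A

element : (p : Subset n) → Fin ∣ p ∣ → ∃ (_∈ p)
element (inside  ∷ p) zero    = zero , here
element (inside  ∷ p) (suc i) = map suc there (element p i)
element (outside ∷ p) i       = map suc there (element p i)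

index : (p : Subset n) → ∃ (_∈ p) → Fin ∣ p ∣
index (inside  ∷ p) (zero  , here)     = zero
index (inside  ∷ p) (suc x , there x∈) = suc (index p (x , x∈))
index (outside ∷ p) (suc x , there x∈) = index p (x , x∈)

element-index : (p : Subset n) → ∀ v → element p (index p v) ≡ v
element-index (inside  ∷ p) (zero  , here)     = refl
element-index (inside  ∷ p) (suc x , there x∈) = cong (map suc there) (element-index p (x , x∈))
element-index (outside ∷ p) (suc x , there x∈) = cong (map suc there) (element-index p (x , x∈))

index-element : (p : Subset n) → ∀ i → index p (element p i) ≡ i
index-element (inside  ∷ p) zero    = refl
index-element (inside  ∷ p) (suc i) = cong suc (index-element p i)
index-element (outside ∷ p) i       = index-element p i

Fin∣∣↔∈ : (p : Subset n) → Fin ∣ p ∣ ↔ ∃ (_∈ p)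
Fin∣∣↔∈ p = mk↔ₛ′ (element p) (index p) (element-index p) (index-element p)

-- Membership proofs are unique, so a vertex of a subgraph is determined by its underlying point.
∈-≡ : {p : Subset n} {u v : ∃ (_∈ p)} → proj₁ u ≡ proj₁ v → u ≡ v
∈-≡ {u = _ , x∈} {v = _ , x∈′} refl = cong (_ ,_) ([]=-irrelevant x∈ x∈′)

∣∣≡1⁺ : {p : Subset n} {x : Fin n} → x ∈ p → (∀ {x′} → x′ ∈ p → x′ ≡ x) → ∣ p ∣ ≡ 1
∣∣≡1⁺ {p = p} x∈ unique = ≤-antisym
  (injective⇒∣∣≤ (Fin∣∣↔∈ p) (mk↔ₛ′ {A = Fin 1} (λ i → i) (λ i → i) (λ _ → refl) (λ _ → refl))
    {f = λ _ → zero} (λ {u} {v} _ → ∈-≡ (trans (unique (proj₂ u)) (sym (unique (proj₂ v))))))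
  (injective⇒≤ {m = 1} {f = λ _ → index p (_ , x∈)} λ { {zero} {zero} _ → refl })

∣∣≡1⁻ : {p : Subset n} → ∣ p ∣ ≡ 1 → ∀ {x x′} → x ∈ p → x′ ∈ p → x ≡ x′
∣∣≡1⁻ {p = p} ∣p∣≡1 x∈ x′∈ = cong proj₁
  (Injection.injective (↔⇒↣ (↔-sym (Fin∣∣↔∈ p))) (Fin-unique ∣p∣≡1 (index p (_ , x∈)) (index p (_ , x′∈))))
  where
  Fin-unique : m ≡ 1 → (i j : Fin m) → i ≡ j
  Fin-unique refl zero zero = refl

-- `_/_` reduces to lowest terms, so the comparison is made between unreduced fractions. `mkℚᵘ`
-- stores the denominator minus one, hence the match on `suc`.
/-cong-* : ∀ {a b c d} .{{_ : NonZero b}} .{{_ : NonZero d}} →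
           a * d ≡ c * b → + a / b ≡ + c / d
/-cong-* {a} {suc b} {c} {suc d} e = fromℚᵘ-cong {mkℚᵘ (+ a) b} {mkℚᵘ (+ c) d}
  (*≡* (trans (sym (ℤ.pos-* a (suc d))) (trans (cong +_ e) (ℤ.pos-* c (suc b)))))

-- Components

module Action (X : Graph) where
  open Graph X

  private
    module Aut = Group (Aut X)

  infixl 8 _·_ _⁻¹·_

  _·_ : Automorphism X → Fin order → Fin order
  σ · x = proj₁ σ x

  _⁻¹·_ : Automorphism X → Fin order → Fin order
  σ ⁻¹· x = σ Aut.⁻¹ · x

  ·-⁻¹· : ∀ σ x → σ · (σ ⁻¹· x) ≡ x
  ·-⁻¹· = Aut.inverseʳ

  ⁻¹·-· : ∀ σ x → σ ⁻¹· (σ · x) ≡ x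
  ⁻¹·-· = Aut.inverseˡ

module _ {X : Graph} where
  open Graph X
  open Action X

  induced : (p : Subset order) → Nonempty p → Subgraph X
  induced p p≢∅ = record
    { vertices  = p
    ; nonempty  = p≢∅
    ; Edge      = λ x y → (x ∈ p × y ∈ p) × x ~ y
    ; edge?     = λ x y → ((x ∈? p) ×-dec (y ∈? p)) ×-dec (x ~? y)
    ; edge-refl = λ x∈ → (x∈ , x∈) , ~-refl
    ; edge-sym  = λ ((x∈ , y∈) , x~y) → (y∈ , x∈) , ~-sym x~y
    ; edge⇒∈    = proj₁
    ; edge⇒~    = proj₂
    }

  module _ (C : Subgraph X) (comp : IsComponent C) where
    open Subgraph C using (Edge; edge⇒∈; edge⇒~)

    -- Maximality of `C` is tested against the subgraph induced on `C` with `x` added. It is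
    -- connected because each of its vertices has a path to `c`: inside `C`, or along the edge from
    -- `x`.
    component-closed : ∀ {c x} → c ∈ vertices C → c ~ x → x ∈ vertices C
    component-closed {c} {x} c∈ c~x = proj₁ (proj₂ comp D D-connected (C⊆D , C⇒D)) x∈D
      where
      D : Subgraph X
      D = induced (vertices C ∪ ⁅ x ⁆) (c , x∈p∪q⁺ (inj₁ c∈))

      C⊆D : ∀ {u} → u ∈ vertices C → u ∈ vertices D
      C⊆D u∈ = x∈p∪q⁺ (inj₁ u∈)

      x∈D : x ∈ vertices D
      x∈D = x∈p∪q⁺ (inj₂ (x∈⁅x⁆ x))

      C⇒D : ∀ {u v} → Edge u v → Subgraph.Edge D u v
      C⇒D e = map C⊆D C⊆D (edge⇒∈ e) , edge⇒~ e

      path-to-c : ∀ {u} → u ∈ vertices D → Star (Subgraph.Edge D) u c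
      path-to-c u∈ with x∈p∪q⁻ (vertices C) ⁅ x ⁆ u∈
      ... | inj₁ u∈C = gmap (λ v → v) C⇒D (proj₁ comp u∈C c∈)
      ... | inj₂ u∈x with refl ← x∈⁅y⁆⇒x≡y x u∈x = ((x∈D , C⊆D c∈) , ~-sym c~x) ◅ ε

      D-connected : Connected D
      D-connected u∈ v∈ = path-to-c u∈ ◅◅ reverse (Subgraph.edge-sym D) (path-to-c v∈)

    component-closed* : ∀ {c x} → c ∈ vertices C → Star _~_ c x → x ∈ vertices C
    component-closed* c∈ ε        = c∈
    component-closed* c∈ (e ◅ es) = component-closed* (component-closed c∈ e) es

    -- `σ` carries a path in `C` from `c` to `x` to a path that starts in `C`, and such a path
    -- cannot leave `C`.
    component-stable : (σ : Automorphism X) → ∀ {c x} → c ∈ vertices C → x ∈ vertices C →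
                       σ · c ∈ vertices C → σ · x ∈ vertices C
    component-stable σ c∈ x∈ σc∈ =
      component-closed* σc∈ (gmap (σ ·_) (homomorphism (proj₂ σ) ∘ edge⇒~) (proj₁ comp c∈ x∈))

-- Fibres

module _ {X Y : Graph} (φ : Hom X Y) where
  open Action X

  ∈fibre⁺ : ∀ {x y} → ⟨ φ ⟩ x ≡ y → x ∈ fibre φ y
  ∈fibre⁺ {y = y} = ∈⟦⟧⁺ (λ x → ⟨ φ ⟩ x ≟ y)

  ∈fibre⁻ : ∀ {x y} → x ∈ fibre φ y → ⟨ φ ⟩ x ≡ y
  ∈fibre⁻ {y = y} = ∈⟦⟧⁻ (λ x → ⟨ φ ⟩ x ≟ y)

  module _ (S : Subgraph X) where

    ∈∩fibre⁺ : ∀ {x y} → x ∈ vertices S → ⟨ φ ⟩ x ≡ y → x ∈ vertices S ∩ fibre φ y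
    ∈∩fibre⁺ x∈ e = x∈p∩q⁺ (x∈ , ∈fibre⁺ e)

    ∈∩fibre⁻ : ∀ {x y} → x ∈ vertices S ∩ fibre φ y → x ∈ vertices S × ⟨ φ ⟩ x ≡ y
    ∈∩fibre⁻ {y = y} x∈ = map (λ z → z) ∈fibre⁻ (x∈p∩q⁻ (vertices S) (fibre φ y) x∈)

    ∈image⁺ : ∀ {x} → x ∈ vertices S → ⟨ φ ⟩ x ∈ vertices (image φ S)
    ∈image⁺ x∈ = ∈⟦⟧⁺ (λ y → any? λ x → (x ∈? vertices S) ×-dec (⟨ φ ⟩ x ≟ y)) (_ , x∈ , refl)

    ∈image⁻ : ∀ {y} → y ∈ vertices (image φ S) → ∃ λ x → x ∈ vertices S × ⟨ φ ⟩ x ≡ y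
    ∈image⁻ = ∈⟦⟧⁻ (λ y → any? λ x → (x ∈? vertices S) ×-dec (⟨ φ ⟩ x ≟ y))

    InjectiveOn : Set
    InjectiveOn = ∀ {x x′} → x ∈ vertices S → x′ ∈ vertices S → ⟨ φ ⟩ x ≡ ⟨ φ ⟩ x′ → x ≡ x′

    k≡1⇒injectiveOn : (∀ {y} → y ∈ vertices (image φ S) → k φ S y ≡ 1) → InjectiveOn
    k≡1⇒injectiveOn k≡1 x∈ x′∈ e =
      ∣∣≡1⁻ (k≡1 (∈image⁺ x′∈)) (∈∩fibre⁺ x∈ e) (∈∩fibre⁺ x′∈ refl)

    injectiveOn⇒k≡1 : InjectiveOn → ∀ {y} → y ∈ vertices (image φ S) → k φ S y ≡ 1
    injectiveOn⇒k≡1 inj y∈ =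
      let x , x∈ , e = ∈image⁻ y∈
      in ∣∣≡1⁺ (∈∩fibre⁺ x∈ e) λ x′∈∩ →
           let x′∈ , e′ = ∈∩fibre⁻ x′∈∩ in inj x′∈ x∈ (trans e′ (sym e))

    -- Surjectivity on vertices and on edges is built into `image`, so only injectivity has to be
    -- supplied.
    injectiveOn⇒≅ : InjectiveOn → S ≅ image φ S
    injectiveOn⇒≅ inj = (λ (x , x∈) → ⟨ φ ⟩ x , ∈image⁺ x∈) , record
      { homomorphism   = λ e → _ , _ , e , refl , refl
      ; injective      = λ {(_ , x∈)} {(_ , x′∈)} e → ∈-≡ (inj x∈ x′∈ (cong proj₁ e))
      ; surjective     = λ (_ , y∈) → let x , x∈ , e = ∈image⁻ y∈ in (x , x∈) , ∈-≡ e
      ; edgeSurjective = λ (x₁ , x₂ , x₁~x₂ , e₁ , e₂) →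
          let x₁∈ , x₂∈ = Subgraph.edge⇒∈ S x₁~x₂
          in (x₁ , x₁∈) , (x₂ , x₂∈) , x₁~x₂ , ∈-≡ e₁ , ∈-≡ e₂
      }

    -- The isomorphism `f` is arbitrary and need not be the restriction of `φ`. Every vertex of `S`
    -- has the form `h v`, and `φ` sends `h v` to `f v`, so `φ` inherits injectivity from `f`.
    ≅⇒injectiveOn : S ≅ image φ S → InjectiveOn
    ≅⇒injectiveOn (f , fIso) {x} {x′} x∈ x′∈ e =
      let v  , hv≡x   = h-surjective (x , x∈)
          v′ , hv′≡x′ = h-surjective (x′ , x′∈)
          fv≡fv′ = ∈-≡ (begin
            proj₁ (f v)           ≡⟨ φ∘h v ⟨
            ⟨ φ ⟩ (proj₁ (h v))   ≡⟨ cong (⟨ φ ⟩ ∘ proj₁) hv≡x ⟩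
            ⟨ φ ⟩ x               ≡⟨ e ⟩
            ⟨ φ ⟩ x′              ≡⟨ cong (⟨ φ ⟩ ∘ proj₁) hv′≡x′ ⟨
            ⟨ φ ⟩ (proj₁ (h v′))  ≡⟨ φ∘h v′ ⟩
            proj₁ (f v′)          ∎)
      in cong proj₁ (trans (sym hv≡x) (trans (cong h (injective fIso fv≡fv′)) hv′≡x′))
      where
      open ≡-Reasoning

      h : Subgraph.Vertex S → Subgraph.Vertex S
      h v = let s , s∈ , _ = ∈image⁻ (proj₂ (f v)) in s , s∈

      φ∘h : ∀ v → ⟨ φ ⟩ (proj₁ (h v)) ≡ proj₁ (f v)
      φ∘h v = proj₂ (proj₂ (∈image⁻ (proj₂ (f v))))

      h-injective : Injective _≡_ _≡_ h
      h-injective {v} {v′} p = injective fIso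
        (∈-≡ (trans (sym (φ∘h v)) (trans (cong (⟨ φ ⟩ ∘ proj₁) p) (φ∘h v′))))

      h-surjective : StrictlySurjective _≡_ h
      h-surjective = injective⇒surjective (Fin∣∣↔∈ (vertices S)) h-injective

  -- Orbit homomorphisms and the counting identity.

  module _ (orbit : IsOrbitHomomorphism φ) where
    private
      𝔊 = proj₁ orbit
      module 𝔊 = Subgroup 𝔊

    -- Total in x and x′, so that carrier x x′ does not depend on a proof that
    -- they lie in the same fibre.
    orbit-carrier : ∀ x x′ → ∃ λ (σ : Automorphism X) →
                    (∀ z → ⟨ φ ⟩ (σ · z) ≡ ⟨ φ ⟩ z) × (⟨ φ ⟩ x ≡ ⟨ φ ⟩ x′ → σ · x ≡ x′)
    orbit-carrier x x′ with ⟨ φ ⟩ x ≟ ⟨ φ ⟩ x′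
    -- The identity is a default: it preserves every fibre, and the conditional claim is vacuous.
    ... | no  φx≢φx′ = Group.ε (Aut X) , (λ _ → refl) , λ e → contradiction e φx≢φx′
    ... | yes φx≡φx′ =
      -- The orbit of `x` is the fibre over some point; the identity of the group shows that this
      -- point is the image of `x`, so `x′` lies in the orbit too.
      let _ , _ , fibre⊆orbit , orbit⊆fibre = proj₂ (proj₂ orbit) x
          φx≡y = ∈fibre⁻ (orbit⊆fibre (Group.ε (Aut X) , 𝔊.ε-closed , refl))
          σ , σ∈𝔊 , σx≡x′ = fibre⊆orbit (∈fibre⁺ (trans (sym φx≡φx′) φx≡y))
      in σ , preserves σ∈𝔊 , λ _ → σx≡x′
      where
      preserves : ∀ {σ} → 𝔊.Member σ → ∀ z → ⟨ φ ⟩ (σ · z) ≡ ⟨ φ ⟩ z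
      preserves {σ} σ∈𝔊 z =
        let _ , _ , _ , orbit⊆fibre = proj₂ (proj₂ orbit) z
        in trans (∈fibre⁻ (orbit⊆fibre (σ , σ∈𝔊 , refl)))
                 (sym (∈fibre⁻ (orbit⊆fibre (Group.ε (Aut X) , 𝔊.ε-closed , refl))))

    carrier : ∀ x x′ → Automorphism X
    carrier x x′ = proj₁ (orbit-carrier x x′)

    carrier-fibre : ∀ x x′ z → ⟨ φ ⟩ (carrier x x′ · z) ≡ ⟨ φ ⟩ z
    carrier-fibre x x′ = proj₁ (proj₂ (orbit-carrier x x′))

    carrier-fibre⁻¹ : ∀ x x′ z → ⟨ φ ⟩ (carrier x x′ ⁻¹· z) ≡ ⟨ φ ⟩ z
    carrier-fibre⁻¹ x x′ z =
      trans (sym (carrier-fibre x x′ _)) (cong ⟨ φ ⟩ (·-⁻¹· (carrier x x′) z))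

    carrier-maps : ∀ {x x′} → ⟨ φ ⟩ x ≡ ⟨ φ ⟩ x′ → carrier x x′ · x ≡ x′
    carrier-maps {x} {x′} = proj₂ (proj₂ (orbit-carrier x x′))

    module _ (C : Subgraph X) (comp : IsComponent C) where
      private
        kX = k φ (whole X)
        kC = k φ C

      kX*kC-≤ : ∀ {c c̄} → c ∈ vertices C → c̄ ∈ vertices C →
                kX (⟨ φ ⟩ c) * kC (⟨ φ ⟩ c̄) ≤ kX (⟨ φ ⟩ c̄) * kC (⟨ φ ⟩ c)
      kX*kC-≤ {c} {c̄} c∈ c̄∈ = injective⇒∣∣≤ pairs↔ pairs↔ {f} f-injective
        where
        Above : Subgraph X → Fin (Graph.order Y) → Set
        Above S y = ∃ (_∈ vertices S ∩ fibre φ y)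

        pairs↔ : ∀ {y ȳ} → Fin (kX y * kC ȳ) ↔ (Above (whole X) y × Above C ȳ)
        pairs↔ {y} {ȳ} = (Fin∣∣↔∈ _ ×-↔ Fin∣∣↔∈ _) ↔-∘ *↔×

        -- `target` and `source` act on bare vertices, so that injectivity can be checked apart from
        -- the membership proofs carried by `f`.
        target : Fin (Graph.order X) → Fin (Graph.order X) → Fin (Graph.order X)
        target a b′ = carrier c a · b′

        source : Fin (Graph.order X) → Fin (Graph.order X) → Fin (Graph.order X)
        source b a = carrier c̄ b ⁻¹· a

        -- The composite of `carrier c a` with `τ⁻¹` sends `b′` to `c̄`, a point of `C`. It
        -- therefore keeps `c` in `C` as well, and it sends `c` to `τ⁻¹` applied to `a`.
        source∈C : ∀ {a b′} → ⟨ φ ⟩ c ≡ ⟨ φ ⟩ a → ⟨ φ ⟩ c̄ ≡ ⟨ φ ⟩ (target a b′) →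
                   b′ ∈ vertices C → source (target a b′) a ∈ vertices C
        source∈C {a} {b′} φc≡φa φc̄≡φb b′∈ =
          subst (λ z → τ ⁻¹· z ∈ vertices C) (carrier-maps φc≡φa)
            (component-stable C comp (τ⁻¹ ∙ carrier c a) b′∈ c∈
              (subst (_∈ vertices C) (sym τ⁻¹b≡c̄) c̄∈))
          where
          open Group (Aut X) using (_∙_; _⁻¹)
          τ   = carrier c̄ (target a b′)
          τ⁻¹ = τ ⁻¹

          τ⁻¹b≡c̄ : τ ⁻¹· target a b′ ≡ c̄
          τ⁻¹b≡c̄ = trans (cong (τ ⁻¹·_) (sym (carrier-maps φc̄≡φb))) (⁻¹·-· τ c̄)

        f : Above (whole X) (⟨ φ ⟩ c) × Above C (⟨ φ ⟩ c̄) →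
            Above (whole X) (⟨ φ ⟩ c̄) × Above C (⟨ φ ⟩ c)
        f ((a , a∈∩) , (b′ , b′∈∩)) =
          let _   , φa≡φc  = ∈∩fibre⁻ (whole X) a∈∩
              b′∈ , φb′≡φc̄ = ∈∩fibre⁻ C b′∈∩
              φb≡φc̄        = trans (carrier-fibre c a b′) φb′≡φc̄
          in (target a b′ , ∈∩fibre⁺ (whole X) ∈⊤ φb≡φc̄) ,
             (source (target a b′) a ,
              ∈∩fibre⁺ C (source∈C (sym φa≡φc) (sym φb≡φc̄) b′∈)
                         (trans (carrier-fibre⁻¹ c̄ _ a) φa≡φc))

        recover : ∀ b a → carrier c̄ b · source b a ≡ a
        recover b a = ·-⁻¹· (carrier c̄ b) a

        -- The target determines the automorphism that `source` inverts, so the two outputs recover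
        -- `a`. With `a` known, `carrier c a` is fixed, and its injectivity recovers `b`.
        raw-injective : ∀ {a₁ a₂ b₁ b₂} → target a₁ b₁ ≡ target a₂ b₂ →
                        source (target a₁ b₁) a₁ ≡ source (target a₂ b₂) a₂ →
                        a₁ ≡ a₂ × b₁ ≡ b₂
        raw-injective {a₁} {a₂} {b₁} {b₂} eᵗ eˢ
          with refl ← trans (sym (recover (target a₁ b₁) a₁))
                            (trans (cong₂ (λ b z → carrier c̄ b · z) eᵗ eˢ)
                                   (recover (target a₂ b₂) a₂))
          = refl , injective (proj₂ (carrier c a₁)) eᵗ

        f-injective : Injective _≡_ _≡_ f
        f-injective e =
          let a≡ , b≡ = raw-injective (cong (proj₁ ∘ proj₁) e) (cong (proj₁ ∘ proj₂) e)
          in cong₂ _,_ (∈-≡ a≡) (∈-≡ b≡)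

      kX*kC-≡ : ∀ {y ȳ} → y ∈ vertices (image φ C) → ȳ ∈ vertices (image φ C) →
                kX y * kC ȳ ≡ kX ȳ * kC y
      kX*kC-≡ y∈ ȳ∈
        with c , c∈ , refl ← ∈image⁻ C y∈ | c̄ , c̄∈ , refl ← ∈image⁻ C ȳ∈
        = ≤-antisym (kX*kC-≤ c∈ c̄∈) (kX*kC-≤ c̄∈ c∈)

      kX-nonZero : ∀ {y} → y ∈ vertices (image φ C) → NonZero (kX y)
      kX-nonZero y∈ with c , _ , refl ← ∈image⁻ C y∈ = k-nonZero φ (whole X) (∈image⁺ (whole X) {c} ∈⊤)

-- The four claims from the counting identity.

proposition7p2 :
    (X Y : Graph) (φ : Hom X Y) → IsComplete φ → IsOrbitHomomorphism φ →
    (C : Subgraph X) → IsComponent C →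
    let kX = k φ (whole X)
        kC = k φ C
        φC = image φ C
        V  = Subgraph.vertices φC
    in
      (∀ {y ȳ} (y∈ : y ∈ V) (ȳ∈ : ȳ ∈ V) →
        _/_ (+ kX y) (kC y) {{k-nonZero φ C y∈}} ≡ _/_ (+ kX ȳ) (kC ȳ) {{k-nonZero φ C ȳ∈}})
      ×
      (C ≅ φC ⇔ (∃ λ y → y ∈ V × kC y ≡ 1 × (∀ ȳ → ȳ ∈ V → kX y ≡ kX ȳ)))
      ×
      ((∃ λ y → y ∈ V × kC y ≡ kX y) → ∀ ȳ → ȳ ∈ V → kC ȳ ≡ kX ȳ)
      ×
      ((∃ λ y → y ∈ V × kC y ≡ kX y × kX y > 1) → ¬ (C ≅ φC))
proposition7p2 X Y φ _ orbit C comp =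
    (λ {y} {ȳ} y∈ ȳ∈ → /-cong-* {kX y} {c = kX ȳ} {{k-nonZero φ C y∈}} {{k-nonZero φ C ȳ∈}} (kX*kC y∈ ȳ∈))
  , mk⇔
      (λ C≅φC →
        -- Any vertex of the image can serve as witness, because `kC` is 1 on all of them.
        let y , y∈ = Subgraph.nonempty (image φ C)
        in y , y∈ , kC≡1 C≅φC y∈ , λ ȳ ȳ∈ → begin
             kX y         ≡⟨ *-identityʳ (kX y) ⟨
             kX y * 1     ≡⟨ cong (kX y *_) (kC≡1 C≅φC ȳ∈) ⟨
             kX y * kC ȳ  ≡⟨ kX*kC y∈ ȳ∈ ⟩
             kX ȳ * kC y  ≡⟨ cong (kX ȳ *_) (kC≡1 C≅φC y∈) ⟩
             kX ȳ * 1     ≡⟨ *-identityʳ (kX ȳ) ⟩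
             kX ȳ         ∎)
      -- Constancy of `kX` lets it be cancelled from the identity, which spreads the value 1 of `kC`
      -- from `y` to the whole image; `φ` is then injective on `C`.
      (λ (y , y∈ , kCy≡1 , kX≡) → injectiveOn⇒≅ φ C (k≡1⇒injectiveOn φ C λ {ȳ} ȳ∈ →
        *-cancelˡ-≡ (kC ȳ) 1 (kX y) {{kX-nonZero φ orbit C comp y∈}} (begin
          kX y * kC ȳ  ≡⟨ kX*kC y∈ ȳ∈ ⟩
          kX ȳ * kC y  ≡⟨ cong₂ _*_ (sym (kX≡ ȳ ȳ∈)) kCy≡1 ⟩
          kX y * 1     ∎)))
  , (λ (y , y∈ , kC≡kX) ȳ ȳ∈ →
      *-cancelˡ-≡ (kC ȳ) (kX ȳ) (kX y) {{kX-nonZero φ orbit C comp y∈}} (begin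
        kX y * kC ȳ  ≡⟨ kX*kC y∈ ȳ∈ ⟩
        kX ȳ * kC y  ≡⟨ cong (kX ȳ *_) kC≡kX ⟩
        kX ȳ * kX y  ≡⟨ *-comm (kX ȳ) (kX y) ⟩
        kX y * kX ȳ  ∎))
  -- An isomorphism would force `kC y`, and with it `kX y`, to be 1.
  , (λ (y , y∈ , kC≡kX , kX>1) C≅φC → <-irrefl (trans (sym (kC≡1 C≅φC y∈)) kC≡kX) kX>1)
  where
  open ≡-Reasoning
  kX = k φ (whole X)
  kC = k φ C

  kX*kC : ∀ {y ȳ} → y ∈ vertices (image φ C) → ȳ ∈ vertices (image φ C) →
          kX y * kC ȳ ≡ kX ȳ * kC y
  kX*kC = kX*kC-≡ φ orbit C comp

  kC≡1 : C ≅ image φ C → ∀ {y} → y ∈ vertices (image φ C) → kC y ≡ 1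
  kC≡1 C≅φC = injectiveOn⇒k≡1 φ C (≅⇒injectiveOn φ C C≅φC)
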